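{- For every integer $k\ge 2$, the Mycielski graph $M_k$ of order $k$ satisfies $\varphi(M_k) = \hat{\varphi}(M_k) = k-2$.
   Context: All graphs are finite, simple and undirected, with at least one vertex. $\chi$ denotes the chromatic number. For a proper vertex coloring $c$ of $G$ and an induced subgraph $H$ of $G$, let $c(H)$ be the set of colors used by $c$ on the vertices of $H$. Define $\varphi_c(G)=\max_{H}\,(|c(H)|-\chi(H))$ over all induced subgraphs $H$ of $G$, and $\hat{\varphi}_c(G)$ as the same maximum taken only over all connected induced subgraphs $H$ of $G$. Define $\varphi(G)=\min_c \varphi_c(G)$ and $\hat{\varphi}(G)=\min_c \hat{\varphi}_c(G)$, the minima over all proper colorings $c$ of $G$ (with any number of colors). For a graph $G$ with vertex set $\{v_1,\ldots,v_n\}$, the Mycielskian $M(G)$ has vertex set $\{v_1,\ldots,v_n\}\cup\{u_1,\ldots,u_n\}\cup\{w\}$ ($2n+1$ distinct vertices) and edge set consisting of (i) all edges of $G$, (ii) the edge $(w,u_i)$ for each $i$, and (iii) the two edges $(v_i,u_j)$ and $(v_j,u_i)$ for each edge $(v_i,v_j)$ of $G$. The Mycielski graphs are defined by $M_2=K_2$ and $M_k=M(M_{k-1})$ for $k\ge 3$. -}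

module Defs where

open import Data.Fin.Base using (Fin; zero; suc; splitAt)
open import Data.Fin.Properties using (any?; _≟_)
open import Data.Fin.Subset using (Subset; _∈_; ∣_∣; Nonempty)
open import Data.Fin.Subset.Properties using (_∈?_)
open import Data.Nat.Base using (ℕ; zero; suc; _+_; _∸_; _≤_; z≤n; s≤s; NonZero)
open import Data.Product.Base using (∃; ∃-syntax; _×_; proj₁)
open import Data.Sum.Base using ([_,_]′)
open import Data.Vec.Base using (tabulate)
open import Function.Base using (_on_; _∘_)
open import Level using (0ℓ)
open import Relation.Binary.Core using (Rel)
open import Relation.Binary.Definitions using (Symmetric; Irreflexive; Decidable)
open import Relation.Binary.Construct.Closure.ReflexiveTransitive using (Star)
open import Relation.Binary.PropositionalEquality using (_≡_; _≢_; refl; sym; cong)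
open import Relation.Nullary using (yes; no; does)
open import Relation.Nullary.Decidable using (_×-dec_; ¬?; map′)

------------------------------------------------------------------------
-- Graphs

record Graph (V : Set) : Set₁ where
  field
    Adj        : Rel V 0ℓ
    adj-sym    : Symmetric Adj
    adj-irrefl : Irreflexive _≡_ Adj
    adj?       : Decidable Adj

open Graph public

record FiniteGraph : Set₁ where
  field
    order        : ℕ
    {{nonEmpty}} : NonZero order
    graph        : Graph (Fin order)

open FiniteGraph public

pullback : ∀ {V W : Set} → (W → V) → Graph V → Graph W
pullback f G = record
  { Adj        = Adj G on f
  ; adj-sym    = adj-sym G
  ; adj-irrefl = λ x≡y → adj-irrefl G (cong f x≡y)
  ; adj?       = λ x y → adj? G (f x) (f y)
  }

-- The subgraph induced by S.  Membership in a Subset is a proposition, so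
-- each element of S gives exactly one vertex.
_[_] : ∀ {n} → Graph (Fin n) → (S : Subset n) → Graph (∃ λ v → v ∈ S)
G [ S ] = pullback proj₁ G

-- For graphs with at least one vertex.
Connected : ∀ {V} → Graph V → Set
Connected G = ∀ x y → Star (Adj G) x y

Proper : ∀ {V C : Set} → Graph V → (V → C) → Set
Proper G c = ∀ {x y} → Adj G x y → c x ≢ c y

Colourable : ∀ {V} → Graph V → ℕ → Set
Colourable {V} G k = ∃ λ (c : V → Fin k) → Proper G c

------------------------------------------------------------------------
-- A parameter defined as an extremum is represented by the relation "its value
-- is m": m belongs to the set of numbers in question and bounds all of it.

IsMinimum : (ℕ → Set) → ℕ → Set
IsMinimum P m = P m × (∀ {x} → P x → m ≤ x)

IsMaximum : (ℕ → Set) → ℕ → Set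
IsMaximum P m = P m × (∀ {x} → P x → x ≤ m)

χ[_]≡_ : ∀ {V} → Graph V → ℕ → Set
χ[ G ]≡ m = IsMinimum (Colourable G) m

------------------------------------------------------------------------
-- φ and φ̂

image : ∀ {n k} → (Fin n → Fin k) → Subset n → Subset k
image c S = tabulate λ j → does (any? λ v → (v ∈? S) ×-dec (c v ≟ j))

-- d = |c(H)| - χ(H) for H = G [ S ].  When c is proper, c restricts to a
-- colouring of H with |c(H)| colours, so the subtraction never truncates.
Excess : ∀ {n k} → Graph (Fin n) → (Fin n → Fin k) → Subset n → ℕ → Set
Excess G c S d = ∃[ m ] χ[ G [ S ] ]≡ m × d ≡ ∣ image c S ∣ ∸ m

φ[_⨾_]≡_ : ∀ {n k} → Graph (Fin n) → (Fin n → Fin k) → ℕ → Set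
φ[ G ⨾ c ]≡ m = IsMaximum (λ d → ∃[ S ] Nonempty S × Excess G c S d) m

φ̂[_⨾_]≡_ : ∀ {n k} → Graph (Fin n) → (Fin n → Fin k) → ℕ → Set
φ̂[ G ⨾ c ]≡ m =
  IsMaximum (λ d → ∃[ S ] Nonempty S × Connected (G [ S ]) × Excess G c S d) m

φ[_]≡_ : FiniteGraph → ℕ → Set
φ[ G ]≡ m = IsMinimum
  (λ d → ∃[ k ] ∃ λ (c : Fin (order G) → Fin k) →
     Proper (graph G) c × φ[ graph G ⨾ c ]≡ d) m

φ̂[_]≡_ : FiniteGraph → ℕ → Set
φ̂[ G ]≡ m = IsMinimum
  (λ d → ∃[ k ] ∃ λ (c : Fin (order G) → Fin k) →
     Proper (graph G) c × φ̂[ graph G ⨾ c ]≡ d) m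

------------------------------------------------------------------------
-- Mycielski graphs

-- old vᵢ, copy vᵢ and apex are the vertices vᵢ, uᵢ and w of the Mycielskian.
data MVertex (V : Set) : Set where
  old copy : V → MVertex V
  apex     : MVertex V

data MAdj {V : Set} (G : Graph V) : Rel (MVertex V) 0ℓ where
  old-old   : ∀ {x y} → Adj G x y → MAdj G (old x) (old y)
  old-copy  : ∀ {x y} → Adj G x y → MAdj G (old x) (copy y)
  copy-old  : ∀ {x y} → Adj G x y → MAdj G (copy x) (old y)
  copy-apex : ∀ {x} → MAdj G (copy x) apex
  apex-copy : ∀ {x} → MAdj G apex (copy x)

mycielskianGraph : ∀ {V} → Graph V → Graph (MVertex V)
mycielskianGraph {V} G = record
  { Adj = MAdj G ; adj-sym = s ; adj-irrefl = i ; adj? = d }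
  where
  s : Symmetric (MAdj G)
  s (old-old e)  = old-old (adj-sym G e)
  s (old-copy e) = copy-old (adj-sym G e)
  s (copy-old e) = old-copy (adj-sym G e)
  s copy-apex    = apex-copy
  s apex-copy    = copy-apex

  i : Irreflexive _≡_ (MAdj G)
  i refl (old-old e) = adj-irrefl G refl e

  d : Decidable (MAdj G)
  d (old x) (old y)   = map′ old-old (λ { (old-old e) → e }) (adj? G x y)
  d (old x) (copy y)  = map′ old-copy (λ { (old-copy e) → e }) (adj? G x y)
  d (copy x) (old y)  = map′ copy-old (λ { (copy-old e) → e }) (adj? G x y)
  d (old _) apex      = no λ ()
  d (copy _) (copy _) = no λ ()
  d (copy _) apex     = yes copy-apex
  d apex     (old _)  = no λ ()
  d apex     (copy _) = yes apex-copy
  d apex     apex     = no λ ()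

-- A bijection numbering the 2n+1 vertices of the Mycielskian.
mvertex : ∀ {n} → Fin (suc (n + n)) → MVertex (Fin n)
mvertex     zero    = apex
mvertex {n} (suc i) = [ old , copy ]′ (splitAt n i)

mycielskian : FiniteGraph → FiniteGraph
mycielskian G = record
  { order = suc (order G + order G)
  ; graph = pullback mvertex (mycielskianGraph (graph G))
  }

complete : ∀ n → {{NonZero n}} → FiniteGraph
complete n = record
  { order = n
  ; graph = record
    { Adj        = _≢_
    ; adj-sym    = λ x≢y → x≢y ∘ sym
    ; adj-irrefl = λ x≡y x≢y → x≢y x≡y
    ; adj?       = λ x y → ¬? (x ≟ y)
    }
  }

mycielski : (k : ℕ) → 2 ≤ k → FiniteGraph
mycielski (suc zero)          (s≤s ())
mycielski (suc (suc zero))    _ = complete 2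
mycielski (suc (suc (suc k))) _ = mycielskian (mycielski (suc (suc k)) (s≤s (s≤s z≤n)))

{-# OPTIONS --safe #-}

-- Lower bound.  In every proper colouring of M_k some vertex has k - 1
-- neighbours of distinct colours.  For the inductive step let a be the colour
-- of w, and recolour every v_i of colour a with the colour of u_i: this is a
-- proper colouring of G avoiding a, so it has a vertex v_i with k - 2
-- neighbours of distinct colours.  If one of these had colour a before, v_i
-- itself has k - 1 differently coloured neighbours in M(G); otherwise u_i does,
-- with w as the additional one.  As M_k is triangle-free, the star at such a
-- vertex is a connected induced subgraph with chromatic number 2 and at least k
-- colours.
--
-- Upper bound.  Give u_i the colour of v_i, and w a new colour.  Inductively,
-- no independent set meets all k colours: it would contain w, hence no u_i, and
-- its remaining vertices would meet all colours of G.  So a subgraph with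
-- chromatic number 1 has at most k - 1 colours.
module Submission where

open import Defs
open import Data.Empty using (⊥-elim)
open import Data.Fin.Base using (Fin; zero; suc; _↑ˡ_; _↑ʳ_)
open import Data.Fin.Properties
  using (any?; _≟_; suc-injective; splitAt-↑ˡ; splitAt-↑ʳ)
open import Data.Fin.Subset using (Subset; _∈_; ∣_∣; Nonempty)
open import Data.Fin.Subset.Properties
  using (_∈?_; ∣p∣≤n; ∣p∣≡n⇒p≡⊤; ∈⊤; x∈p⇒∣p-x∣<∣p∣; x∈p∧x≢y⇒x∈p-y)
open import Data.Nat.Base
  using (ℕ; zero; suc; _+_; _∸_; _≤_; z≤n; s≤s; s≤s⁻¹)
open import Data.Nat.Properties
  using (≤-trans; ≤-antisym; ∸-monoˡ-≤; ∸-mono; ≤∧≢⇒<)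
open import Data.Product.Base using (∃; ∃-syntax; _×_; _,_; proj₁; proj₂)
open import Data.Sum.Base using (_⊎_; inj₁; inj₂; [_,_]′)
open import Data.Vec.Base using (tabulate)
open import Data.Vec.Properties using (lookup∘tabulate; []=⇒lookup; lookup⇒[]=)
open import Function.Base using (_∘_)
open import Function.Definitions using (Injective)
open import Relation.Binary.Construct.Closure.ReflexiveTransitive
  using (Star; ε; _◅_; _◅◅_; reverse)
open import Relation.Binary.Definitions using (DecidableEquality)
open import Relation.Binary.PropositionalEquality
  using (_≡_; _≢_; refl; sym; trans; cong; subst; subst₂)
open import Relation.Nullary using (¬_; Dec; yes; no; does)
open import Relation.Nullary.Decidable using (_×-dec_; _⊎-dec_; dec-true)

private
  variable
    V W : Set
    m n k : ℕ

-- Rainbow neighbours and independent transversals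

TriangleFree : Graph V → Set
TriangleFree G = ∀ {x y z} → Adj G x y → Adj G y z → ¬ Adj G x z

RainbowNeighbours : {C : Set} → Graph V → (V → C) → V → ℕ → Set
RainbowNeighbours {V} G c v m =
  ∃ λ (f : Fin m → V) → (∀ i → Adj G v (f i)) × Injective _≡_ _≡_ (c ∘ f)

-- Colours come from an arbitrary type, so the recolouring in the inductive step can stay inside the
-- given one; it has to compare colours with that of `apex`, hence the decidable equality.
ForcesRainbowNeighbours : Graph V → ℕ → Set₁
ForcesRainbowNeighbours {V} G m =
  ∀ {C : Set} → DecidableEquality C → (c : V → C) → Proper G c →
  ∃ λ v → RainbowNeighbours G c v m

NoIndependentTransversal : Graph V → (V → Fin k) → Set
NoIndependentTransversal {V} {k} G c =
  ∀ (f : Fin k → V) → (∀ i → c (f i) ≡ i) → ¬ (∀ i j → ¬ Adj G (f i) (f j))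

-- The induction invariant, with `m` standing for `k - 2`, so that all counts are successors.
record MycielskiLike (G : Graph V) (m : ℕ) : Set₁ where
  field
    triangleFree  : TriangleFree G
    forces        : ForcesRainbowNeighbours G (suc m)
    colouring     : V → Fin (suc (suc m))
    proper        : Proper G colouring
    noTransversal : NoIndependentTransversal G colouring

-- Renumbering the vertices

module _ {g : W → V} {s : V → W} (gs : ∀ x → g (s x) ≡ x) (G : Graph V) where

  private
    lift : ∀ {x y} → Adj G x y → Adj (pullback g G) (s x) (s y)
    lift = subst₂ (Adj G) (sym (gs _)) (sym (gs _))

  -- A colouring of the pullback restricts along the section `s` to one of `G`, and `s` carries the
  -- neighbours found there back.
  forces-pullback : ForcesRainbowNeighbours G m →
                    ForcesRainbowNeighbours (pullback g G) m
  forces-pullback forces _≟C_ c proper =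
    let v , f , adj , inj = forces _≟C_ (c ∘ s) (proper ∘ lift)
    in s v , s ∘ f , lift ∘ adj , inj

  mycielskiLike-pullback : MycielskiLike G m → MycielskiLike (pullback g G) m
  mycielskiLike-pullback L = record
    { triangleFree  = triangleFree
    ; forces        = forces-pullback forces
    ; colouring     = colouring ∘ g
    ; proper        = proper
    ; noTransversal = λ f → noTransversal (g ∘ f)
    }
    where open MycielskiLike L

-- The Mycielskian

-- Copies are pairwise non-adjacent, so a triangle has at most one copy and avoids `apex`. Replacing
-- the copy by its original gives a triangle of `G`.
triangleFree-mycielskian : {G : Graph V} → TriangleFree G →
                           TriangleFree (mycielskianGraph G)
triangleFree-mycielskian t (old-old a)  (old-old b)  (old-old d)  = t a b d
triangleFree-mycielskian t (old-old a)  (old-copy b) (old-copy d) = t a b d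
triangleFree-mycielskian t (old-copy a) (copy-old b) (old-old d)  = t a b d
triangleFree-mycielskian t (old-copy a) copy-apex    ()
triangleFree-mycielskian t (copy-old a) (old-old b)  (copy-old d) = t a b d
triangleFree-mycielskian t (copy-old a) (old-copy b) ()
triangleFree-mycielskian t copy-apex    apex-copy    ()
triangleFree-mycielskian t apex-copy    (copy-old b) ()
triangleFree-mycielskian t apex-copy    copy-apex    ()

cons : {A : Set} → A → (Fin m → A) → Fin (suc m) → A
cons x f zero    = x
cons x f (suc i) = f i

cons-all : {A : Set} (P : A → Set) {x : A} {f : Fin m → A} →
           P x → (∀ i → P (f i)) → ∀ i → P (cons x f i)
cons-all P px pf zero    = px
cons-all P px pf (suc i) = pf i

cons-injective : {A C : Set} (c : A → C) {x : A} {f : Fin m → A} →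
                 (∀ i → c (f i) ≢ c x) → Injective _≡_ _≡_ (c ∘ f) →
                 Injective _≡_ _≡_ (c ∘ cons x f)
cons-injective c x∉f inj {zero}  {zero}  _  = refl
cons-injective c x∉f inj {zero}  {suc j} eq = ⊥-elim (x∉f j (sym eq))
cons-injective c x∉f inj {suc i} {zero}  eq = ⊥-elim (x∉f i eq)
cons-injective c x∉f inj {suc i} {suc j} eq = cong suc (inj eq)

module _ {C : Set} (_≟C_ : DecidableEquality C) {G : Graph V}
         (c : MVertex V → C) (proper : Proper (mycielskianGraph G) c) where

  private
    -- The recolouring selects a vertex whose colour `x` takes over; keeping the vertex lets
    -- neighbours in `G` be read as neighbours in the Mycielskian.
    representative : ∀ x → Dec (c (old x) ≡ c apex) → MVertex V
    representative x (yes _) = copy x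
    representative x (no _)  = old x

    rep : V → MVertex V
    rep x = representative x (c (old x) ≟C c apex)

    rep≢apex : ∀ x → c (rep x) ≢ c apex
    rep≢apex x with c (old x) ≟C c apex
    ... | yes _ = proper copy-apex
    ... | no  ≢ = ≢

    rep≡old : ∀ {x} → c (old x) ≢ c apex → rep x ≡ old x
    rep≡old {x} ≢ with c (old x) ≟C c apex
    ... | yes ≡ = ⊥-elim (≢ ≡)
    ... | no  _ = refl

    old-rep : ∀ {x y} → Adj G x y → MAdj G (old x) (rep y)
    old-rep {y = y} a with c (old y) ≟C c apex
    ... | yes _ = old-copy a
    ... | no  _ = old-old a

    rep-proper : Proper G (c ∘ rep)
    rep-proper {x} {y} a with c (old x) ≟C c apex | c (old y) ≟C c apex
    -- Two copies would not be adjacent, but adjacent old vertices cannot both have the colour of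
    -- `apex`.
    ... | yes p | yes q = λ _ → proper (old-old a) (trans p (sym q))
    ... | yes _ | no _  = proper (copy-old a)
    ... | no _  | yes _ = proper (old-copy a)
    ... | no _  | no _  = proper (old-old a)

  rainbowNeighbours-mycielskian :
    ForcesRainbowNeighbours G m →
    ∃ λ v → RainbowNeighbours (mycielskianGraph G) c v (suc m)
  rainbowNeighbours-mycielskian forces with forces _≟C_ (c ∘ rep) rep-proper
  ... | v , f , adj , inj with any? (λ i → c (old (f i)) ≟C c apex)
  -- `old (f i₀)` has the colour of `apex`, which no representative has.
  ...   | yes (i₀ , eq) =
    old v , cons (old (f i₀)) (rep ∘ f)
    , cons-all (MAdj G (old v)) (old-old (adj i₀)) (old-rep ∘ adj)
    , cons-injective c (λ i e → rep≢apex (f i) (trans e eq)) inj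
  -- No `f i` was recoloured, so the old vertices keep the distinct colours, and `apex` adds its
  -- own.
  ...   | no none =
    copy v , cons apex (old ∘ f)
    , cons-all (MAdj G (copy v)) copy-apex (copy-old ∘ adj)
    , cons-injective c old≢apex
        (λ {i} {j} e → inj (subst₂ (λ p q → c p ≡ c q)
          (sym (rep≡old (old≢apex i))) (sym (rep≡old (old≢apex j))) e))
    where
    old≢apex : ∀ i → c (old (f i)) ≢ c apex
    old≢apex i e = none (i , e)

mycielskianColouring : (V → Fin k) → MVertex V → Fin (suc k)
mycielskianColouring c (old x)  = suc (c x)
mycielskianColouring c (copy x) = suc (c x)
mycielskianColouring c apex     = zero

mycielskianColouring-proper : {G : Graph V} {c : V → Fin k} → Proper G c →
                              Proper (mycielskianGraph G) (mycielskianColouring c)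
mycielskianColouring-proper p (old-old a)  eq = p a (suc-injective eq)
mycielskianColouring-proper p (old-copy a) eq = p a (suc-injective eq)
mycielskianColouring-proper p (copy-old a) eq = p a (suc-injective eq)
mycielskianColouring-proper p copy-apex    ()
mycielskianColouring-proper p apex-copy    ()

module _ {G : Graph V} {c : V → Fin k} where

  private
    colour-zero : ∀ x → mycielskianColouring c x ≡ zero → x ≡ apex
    colour-zero apex _ = refl

    colour-suc : ∀ {i} x → mycielskianColouring c x ≡ suc i → ¬ MAdj G apex x →
                 ∃ λ y → x ≡ old y × c y ≡ i
    colour-suc (old y)  eq ¬a = y , refl , suc-injective eq
    colour-suc (copy y) eq ¬a = ⊥-elim (¬a apex-copy)

  noTransversal-mycielskian :
    NoIndependentTransversal G c →
    NoIndependentTransversal (mycielskianGraph G) (mycielskianColouring c)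
  noTransversal-mycielskian none f cf ind =
    none (proj₁ ∘ g) (proj₂ ∘ proj₂ ∘ g)
      (λ i j a → ind (suc i) (suc j)
        (subst₂ (MAdj G) (sym (f≡old i)) (sym (f≡old j)) (old-old a)))
    where
    f₀≡apex : f zero ≡ apex
    f₀≡apex = colour-zero (f zero) (cf zero)

    g : ∀ i → ∃ λ y → f (suc i) ≡ old y × c y ≡ i
    g i = colour-suc (f (suc i)) (cf (suc i))
      (ind zero (suc i) ∘ subst (λ x → MAdj G x (f (suc i))) (sym f₀≡apex))

    f≡old : ∀ i → f (suc i) ≡ old (proj₁ (g i))
    f≡old i = proj₁ (proj₂ (g i))

mycielskiLike-mycielskian : {G : Graph V} → MycielskiLike G m →
                            MycielskiLike (mycielskianGraph G) (suc m)
mycielskiLike-mycielskian {G = G} L = record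
  { triangleFree  = triangleFree-mycielskian triangleFree
  ; forces        = λ _≟C_ c p → rainbowNeighbours-mycielskian _≟C_ c p forces
  ; colouring     = mycielskianColouring colouring
  ; proper        = mycielskianColouring-proper proper
  ; noTransversal = noTransversal-mycielskian noTransversal
  }
  where open MycielskiLike L

-- The Mycielski graphs

number : MVertex (Fin n) → Fin (suc (n + n))
number {n} (old i)  = suc (i ↑ˡ n)
number {n} (copy i) = suc (n ↑ʳ i)
number     apex     = zero

mvertex-number : (x : MVertex (Fin n)) → mvertex (number x) ≡ x
mvertex-number {n} (old i)  = cong [ old , copy ]′ (splitAt-↑ˡ n i n)
mvertex-number {n} (copy i) = cong [ old , copy ]′ (splitAt-↑ʳ n n i)
mvertex-number     apex     = refl

mycielskiLike-K₂ : MycielskiLike (graph (complete 2)) 0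
mycielskiLike-K₂ = record
  { triangleFree  = triangleFree
  ; forces        = λ _ _ _ →
      zero , (λ _ → suc zero) , (λ _ ()) , λ { {zero} {zero} _ → refl }
  ; colouring     = λ x → x
  ; proper        = λ x≢y → x≢y
  -- A transversal of the identity colouring contains both ends of the edge.
  ; noTransversal = λ f cf ind → ind zero (suc zero)
      (subst₂ _≢_ (sym (cf zero)) (sym (cf (suc zero))) λ ())
  }
  where
  triangleFree : TriangleFree (graph (complete 2))
  triangleFree {zero}     {zero}     a b d = a refl
  triangleFree {zero}     {suc zero} {zero}     a b d = d refl
  triangleFree {zero}     {suc zero} {suc zero} a b d = b refl
  triangleFree {suc zero} {suc zero} a b d = a refl
  triangleFree {suc zero} {zero}     {suc zero} a b d = d refl
  triangleFree {suc zero} {zero}     {zero}     a b d = b refl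

mycielskiLike-mycielski : ∀ k 2≤k → MycielskiLike (graph (mycielski k 2≤k)) (k ∸ 2)
mycielskiLike-mycielski (suc zero)          (s≤s ())
mycielskiLike-mycielski (suc (suc zero))    _ = mycielskiLike-K₂
mycielskiLike-mycielski (suc (suc (suc k))) _ =
  mycielskiLike-pullback {s = number} mvertex-number _
    (mycielskiLike-mycielskian (mycielskiLike-mycielski (suc (suc k)) (s≤s (s≤s z≤n))))

-- Subsets and images

module _ {P : Fin n → Set} (P? : ∀ x → Dec (P x)) where

  ∈-tabulate⁺ : ∀ {x} → P x → x ∈ tabulate (does ∘ P?)
  ∈-tabulate⁺ {x} px =
    lookup⇒[]= x _ (trans (lookup∘tabulate (does ∘ P?) x) (dec-true (P? x) px))

  ∈-tabulate⁻ : ∀ {x} → x ∈ tabulate (does ∘ P?) → P x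
  ∈-tabulate⁻ {x} x∈ with P? x | trans (sym (lookup∘tabulate (does ∘ P?) x)) ([]=⇒lookup x∈)
  ... | yes px | _  = px
  ... | no  _  | ()

module _ {c : Fin n → Fin k} {S : Subset n} where

  ∈-image⁺ : ∀ {v} → v ∈ S → c v ∈ image c S
  ∈-image⁺ v∈S =
    ∈-tabulate⁺ (λ j → any? λ v → (v ∈? S) ×-dec (c v ≟ j)) (_ , v∈S , refl)

  ∈-image⁻ : ∀ {j} → j ∈ image c S → ∃ λ v → v ∈ S × c v ≡ j
  ∈-image⁻ = ∈-tabulate⁻ (λ j → any? λ v → (v ∈? S) ×-dec (c v ≟ j))

-- Induction on `m`: removing `f zero` from `p` keeps all the other values.
injection⇒≤∣p∣ : (f : Fin m → Fin n) → Injective _≡_ _≡_ f →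
                {p : Subset n} → (∀ i → f i ∈ p) → m ≤ ∣ p ∣
injection⇒≤∣p∣ {zero}  f inj f∈p = z≤n
injection⇒≤∣p∣ {suc m} f inj {p} f∈p = ≤-trans
  (s≤s (injection⇒≤∣p∣ (f ∘ suc) (suc-injective ∘ inj)
    λ i → x∈p∧x≢y⇒x∈p-y (f∈p (suc i)) λ eq → suc≢zero (inj eq)))
  (x∈p⇒∣p-x∣<∣p∣ (f∈p zero))
  where
  suc≢zero : ∀ {n} {i : Fin n} → suc i ≢ zero
  suc≢zero ()

adjacent⇒2≤ : (G : Graph V) → Colourable G k → ∀ {x y} → Adj G x y → 2 ≤ k
adjacent⇒2≤ {k = zero}        _ (c , _) {x} _ with () ← c x
adjacent⇒2≤ {k = suc zero}    _ (c , proper) {x} {y} a with c x | c y | proper a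
... | zero | zero | ≢ = ⊥-elim (≢ refl)
adjacent⇒2≤ {k = suc (suc _)} _ _ _ = s≤s (s≤s z≤n)

-- Stars

module _ (G : Graph (Fin n)) (v : Fin n) where

  private
    inStar? : ∀ x → Dec (x ≡ v ⊎ Adj G v x)
    inStar? x = (x ≟ v) ⊎-dec adj? G v x

  star : Subset n
  star = tabulate (does ∘ inStar?)

  centre∈star : v ∈ star
  centre∈star = ∈-tabulate⁺ inStar? (inj₁ refl)

  neighbour∈star : ∀ {x} → Adj G v x → x ∈ star
  neighbour∈star a = ∈-tabulate⁺ inStar? (inj₂ a)

  -- The centre is reached from itself along an edge and back, which avoids
  -- comparing two proofs of v ∈ star.
  star-connected : ∀ {u} → Adj G v u → Connected (G [ star ])
  star-connected {u} vu x y = reach x ◅◅ reverse (adj-sym G) (reach y)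
    where
    reach : ∀ x → Star (Adj (G [ star ])) x (v , centre∈star)
    reach (x , x∈) with ∈-tabulate⁻ inStar? x∈
    ... | inj₁ refl = _◅_ {j = u , neighbour∈star vu} vu (adj-sym G vu ◅ ε)
    ... | inj₂ vx   = adj-sym G vx ◅ ε

  -- Neighbours of `v` are pairwise non-adjacent, so one colour serves them all; the edge to `u`
  -- rules out fewer than two colours.
  χ-star : TriangleFree G → ∀ {u} → Adj G v u → χ[ G [ star ] ]≡ 2
  χ-star triangleFree {u} vu =
    (c , proper) ,
    λ col → adjacent⇒2≤ (G [ star ]) col {v , centre∈star} {u , neighbour∈star vu} vu
    where
    c : (∃ λ x → x ∈ star) → Fin 2
    c (x , _) with x ≟ v
    ... | yes _ = zero
    ... | no  _ = suc zero

    proper : Proper (G [ star ]) c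
    proper {x , x∈} {y , y∈} a eq with x ≟ v | y ≟ v
    ... | yes p | yes q = adj-irrefl G (trans p (sym q)) a
    ... | no ≢v | no ≢v′ with ∈-tabulate⁻ inStar? x∈ | ∈-tabulate⁻ inStar? y∈
    ...   | inj₁ p  | _       = ≢v p
    ...   | inj₂ _  | inj₁ q  = ≢v′ q
    ...   | inj₂ vx | inj₂ vy = triangleFree vx a vy

  rainbow-star : {c : Fin n → Fin k} → Proper G c →
                 RainbowNeighbours G c v m → suc m ≤ ∣ image c star ∣
  rainbow-star {c = c} proper (f , adj , inj) =
    injection⇒≤∣p∣ (c ∘ cons v f)
      (cons-injective c (λ i eq → proper (adj i) (sym eq)) inj)
      (λ i → ∈-image⁺ {c = c}
        (cons-all (_∈ star) centre∈star (neighbour∈star ∘ adj) i))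

-- φ and φ̂

module _ {G : Graph (Fin n)} (L : MycielskiLike G m) where
  open MycielskiLike L

  ConnectedExcess : (Fin n → Fin k) → ℕ → Set
  ConnectedExcess c d = ∃[ S ] Nonempty S × Connected (G [ S ]) × Excess G c S d

  large-excess : (c : Fin n → Fin k) → Proper G c →
                 ∃[ d ] m ≤ d × ConnectedExcess c d
  large-excess c proper with forces _≟_ c proper
  ... | v , r@(f , adj , _) =
    -- The centre and its `m + 1` rainbow neighbours show `m + 2` colours, from which the chromatic
    -- number 2 is subtracted.
    _ , ∸-monoˡ-≤ 2 (rainbow-star G v proper r) ,
    star G v , (v , centre∈star G v) , star-connected G v (adj zero) ,
    2 , χ-star G v triangleFree (adj zero) , refl

  independent-image : ∀ S → Colourable (G [ S ]) 1 → ∣ image colouring S ∣ ≤ suc m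
  independent-image S col = s≤s⁻¹ (≤∧≢⇒< (∣p∣≤n (image colouring S)) not-full)
    where
    not-full : ∣ image colouring S ∣ ≢ suc (suc m)
    not-full eq = noTransversal (proj₁ ∘ g) (proj₂ ∘ proj₂ ∘ g) independent
      where
      -- An image of full size is everything, so each colour has a vertex in `S`.
      g : ∀ i → ∃ λ v → v ∈ S × colouring v ≡ i
      g i = ∈-image⁻ {c = colouring} {S} (subst (i ∈_) (sym (∣p∣≡n⇒p≡⊤ eq)) ∈⊤)

      independent : ∀ i j → ¬ Adj G (proj₁ (g i)) (proj₁ (g j))
      independent i j a with adjacent⇒2≤ (G [ S ]) col
        {proj₁ (g i) , proj₁ (proj₂ (g i))} {proj₁ (g j) , proj₁ (proj₂ (g j))} a
      ... | s≤s ()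

  -- By chromatic number: 0 is impossible on a nonempty set, 1 means independent and leaves at most
  -- `m + 1` colours, and from 2 on the total of `m + 2` colours suffices.
  excess≤m : ∀ {S d} → Nonempty S → Excess G colouring S d → d ≤ m
  excess≤m (x , x∈) (zero , ((c , _) , _) , _) with () ← c (x , x∈)
  excess≤m {S} _ (suc zero , (col , _) , refl) = ∸-monoˡ-≤ 1 (independent-image S col)
  excess≤m {S} _ (suc (suc χ) , _ , refl) =
    ∸-mono (∣p∣≤n (image colouring S)) (s≤s (s≤s (z≤n {χ})))

  private
    -- The star has excess at least `m` and the upper bound makes it exactly `m`. Being connected,
    -- it is a witness for both parameters.
    attained : ConnectedExcess colouring m
    attained with large-excess colouring proper
    ... | d , m≤d , S , S≠∅ , conn , ex =
      S , S≠∅ , conn ,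
      subst (Excess G colouring S) (≤-antisym (excess≤m S≠∅ ex) m≤d) ex

  φ-colouring : φ[ G ⨾ colouring ]≡ m
  φ-colouring =
    (let S , S≠∅ , _ , ex = attained in S , S≠∅ , ex) ,
    λ { (_ , S≠∅ , ex) → excess≤m S≠∅ ex }

  φ̂-colouring : φ̂[ G ⨾ colouring ]≡ m
  φ̂-colouring = attained , λ { (_ , S≠∅ , _ , ex) → excess≤m S≠∅ ex }

  m≤φ : ∀ {d} (c : Fin n → Fin k) → Proper G c → φ[ G ⨾ c ]≡ d → m ≤ d
  m≤φ c p (_ , upper) with large-excess c p
  ... | _ , m≤ , S , S≠∅ , _ , ex = ≤-trans m≤ (upper (S , S≠∅ , ex))

  m≤φ̂ : ∀ {d} (c : Fin n → Fin k) → Proper G c → φ̂[ G ⨾ c ]≡ d → m ≤ d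
  m≤φ̂ c p (_ , upper) with large-excess c p
  ... | _ , m≤ , ex = ≤-trans m≤ (upper ex)

theorem7p4 : ∀ (k : ℕ) (2≤k : 2 ≤ k) →
    (φ[ mycielski k 2≤k ]≡ (k ∸ 2)) × (φ̂[ mycielski k 2≤k ]≡ (k ∸ 2))
theorem7p4 k 2≤k =
  ((_ , colouring , proper , φ-colouring L) , λ { (_ , c , p , v) → m≤φ L c p v }) ,
  ((_ , colouring , proper , φ̂-colouring L) , λ { (_ , c , p , v) → m≤φ̂ L c p v })
  where
  L : MycielskiLike (graph (mycielski k 2≤k)) (k ∸ 2)
  L = mycielskiLike-mycielski k 2≤k
  open MycielskiLike L
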